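{- Let $\mathcal{A}$ be a finite set of positive integers, let $w \leqslant z$ be real numbers, and let $m_1, m_2$ be real numbers with $(m_1, m_2) \in \mathcal{U}$. Then $$ S(\mathcal{A}, z) \leqslant S(\mathcal{A}, w) - \frac{m_1 + m_2 - 1}{m_1 m_2} \sum_{w \leqslant p_1 < z} S(\mathcal{A}_{p_1}, w) + \frac{2}{m_1 m_2} \sum_{w \leqslant p_2 < p_1 < z} S(\mathcal{A}_{p_1 p_2}, w). $$
   Context: Throughout, $p, p_1, p_2, \dots$ denote prime numbers. For a finite set $\mathcal{A}$ of positive integers and a positive integer $d$, $\mathcal{A}_d = \{a : ad \in \mathcal{A}\}$. For real $z$, $S(\mathcal{A}, z)$ denotes the number of $a \in \mathcal{A}$ having no prime factor less than $z$. Let $T = (0,1] \cup [2,3] \cup [4,5] \cup \cdots$, i.e. $T$ is the union of $(0,1]$ and the intervals $[k-1,k]$ over all odd integers $k \geqslant 3$, and let $\mathcal{U} = \{(x_1, x_2) : x_1, x_2 \in T,\ |x_1 - x_2| \leqslant 1\}$. -}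

module Defs where

open import Axiom.ExcludedMiddle using (ExcludedMiddle)
open import Data.Empty using (⊥-elim)
open import Data.Integer.Base as ℤ using (+_; -[1+_])
import Data.Integer.Properties as ℤ
open import Data.List.Base using (List; filter; length; map; upTo)
open import Data.List.Extrema.Nat using (max; xs≤max)
open import Data.List.Membership.Propositional using (_∈_)
open import Data.List.Membership.Propositional.Properties
  using (∈-filter⁺; ∈-filter⁻; ∈-upTo⁺)
open import Data.List.Membership.DecPropositional using () renaming (_∈?_ to mem?)
open import Data.List.Relation.Unary.All as All using (All)
open import Data.List.Relation.Unary.Unique.Propositional using (Unique)
import Data.List.Relation.Unary.Unique.Propositional.Properties as Unique
open import Data.Nat.Base as ℕ using (ℕ; zero; suc; z≤n; s≤s)
open import Data.Nat.Divisibility using (_∣_)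
open import Data.Nat.ListAction using (sum)
open import Data.Nat.Primality using (Prime; prime?)
import Data.Nat.Properties as ℕ
open import Data.Product using (∃; _×_; _,_; proj₁; proj₂)
open import Data.Rational.Base as ℚ using (ℚ; 0ℚ; 1ℚ; ½; mkℚ)
import Data.Rational.Properties as ℚ
import Data.Rational.Unnormalised.Base as ℚᵘ
import Data.Rational.Unnormalised.Properties as ℚᵘ
open import Data.Rational.Solver using (module +-*-Solver)
open import Data.Sum.Base using (_⊎_; inj₁; inj₂)
open import Function.Bundles using (_⇔_; mk⇔)
open import Level using (0ℓ)
open import Relation.Binary.PropositionalEquality
  using (_≡_; _≢_; refl; sym; trans; cong; cong₂; subst)
open import Relation.Nullary using (¬_; Dec; yes; no)
open import Relation.Nullary.Decidable using (_×-dec_)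
open import Relation.Unary using (Pred)

0<* : ∀ {p q} → 0ℚ ℚ.< p → 0ℚ ℚ.< q → 0ℚ ℚ.< p ℚ.* q
0<* {p} {q} 0<p 0<q =
  ℚ.positive⁻¹ (p ℚ.* q) {{ℚ.pos*pos⇒pos p {{ℚ.positive 0<p}} q {{ℚ.positive 0<q}}}}

0<½ : 0ℚ ℚ.< ½
0<½ = ℚ.positive⁻¹ ½

0<1 : 0ℚ ℚ.< 1ℚ
0<1 = ℚ.positive⁻¹ 1ℚ

halves : ∀ p → ½ ℚ.* p ℚ.+ ½ ℚ.* p ≡ p
halves p = trans (sym (ℚ.*-distribʳ-+ p ½ ½)) (ℚ.*-identityˡ p)

*-mono-nonNeg : ∀ {p q r s} → 0ℚ ℚ.≤ r → 0ℚ ℚ.≤ q → p ℚ.≤ q → r ℚ.≤ s → p ℚ.* r ℚ.≤ q ℚ.* s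
*-mono-nonNeg {p} {q} {r} {s} 0≤r 0≤q p≤q r≤s = ℚ.≤-trans
  (ℚ.*-monoʳ-≤-nonNeg r {{ℚ.nonNegative 0≤r}} p≤q)
  (ℚ.*-monoˡ-≤-nonNeg q {{ℚ.nonNegative 0≤q}} r≤s)

p≤∣p∣ : ∀ p → p ℚ.≤ ℚ.∣ p ∣
p≤∣p∣ p with ℚ.≤-total 0ℚ p
... | inj₁ 0≤p = ℚ.≤-reflexive (sym (ℚ.0≤p⇒∣p∣≡p 0≤p))
... | inj₂ p≤0 = ℚ.≤-trans p≤0 (ℚ.0≤∣p∣ p)

∣p∣≤∣q∣+∣p-q∣ : ∀ p q → ℚ.∣ p ∣ ℚ.≤ ℚ.∣ q ∣ ℚ.+ ℚ.∣ p ℚ.- q ∣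
∣p∣≤∣q∣+∣p-q∣ p q = subst (λ r → ℚ.∣ r ∣ ℚ.≤ ℚ.∣ q ∣ ℚ.+ ℚ.∣ p ℚ.- q ∣)
  (solve 2 (λ p q → q :+ (p :- q) := p) refl p q)
  (ℚ.∣p+q∣≤∣p∣+∣q∣ q (p ℚ.- q))
  where open +-*-Solver

∣p-q∣≡∣q-p∣ : ∀ p q → ℚ.∣ p ℚ.- q ∣ ≡ ℚ.∣ q ℚ.- p ∣
∣p-q∣≡∣q-p∣ p q = trans (sym (ℚ.∣-p∣≡∣p∣ (p ℚ.- q)))
  (cong ℚ.∣_∣ (solve 2 (λ p q → :- (p :- q) := q :- p) refl p q))
  where open +-*-Solver

∣∣p∣-∣q∣∣≤∣p-q∣ : ∀ p q → ℚ.∣ ℚ.∣ p ∣ ℚ.- ℚ.∣ q ∣ ∣ ℚ.≤ ℚ.∣ p ℚ.- q ∣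
∣∣p∣-∣q∣∣≤∣p-q∣ p q with ℚ.∣p∣≡p∨∣p∣≡-p (ℚ.∣ p ∣ ℚ.- ℚ.∣ q ∣)
... | inj₁ eq = subst (ℚ._≤ ℚ.∣ p ℚ.- q ∣) (sym eq) (shift p q)
  where
  open +-*-Solver
  shift : ∀ p q → ℚ.∣ p ∣ ℚ.- ℚ.∣ q ∣ ℚ.≤ ℚ.∣ p ℚ.- q ∣
  shift p q = subst (ℚ.∣ p ∣ ℚ.- ℚ.∣ q ∣ ℚ.≤_)
    (solve 2 (λ a b → (a :+ b) :- a := b) refl ℚ.∣ q ∣ ℚ.∣ p ℚ.- q ∣)
    (ℚ.+-monoˡ-≤ (ℚ.- ℚ.∣ q ∣) (∣p∣≤∣q∣+∣p-q∣ p q))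
... | inj₂ eq = subst (ℚ._≤ ℚ.∣ p ℚ.- q ∣)
  (sym (trans eq (solve 2 (λ a b → :- (a :- b) := b :- a) refl ℚ.∣ p ∣ ℚ.∣ q ∣)))
  (subst (ℚ.∣ q ∣ ℚ.- ℚ.∣ p ∣ ℚ.≤_)
    (trans (solve 2 (λ a b → (a :+ b) :- a := b) refl ℚ.∣ p ∣ ℚ.∣ q ℚ.- p ∣) (∣p-q∣≡∣q-p∣ q p))
    (ℚ.+-monoˡ-≤ (ℚ.- ℚ.∣ p ∣) (∣p∣≤∣q∣+∣p-q∣ q p)))
  where open +-*-Solver

/1-cancel-< : ∀ {m n} → (+ m ℚ./ 1) ℚ.< (+ n ℚ./ 1) → m ℕ.< n
/1-cancel-< {m} {n} m<n = ℤ.drop‿+<+ (subst₂′ (ℤ.*-identityʳ (+ m)) (ℤ.*-identityʳ (+ n))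
  (ℚᵘ.drop-*<* (ℚᵘ.<-respˡ-≃ (ℚ.toℚᵘ-fromℚᵘ (ℚᵘ.mkℚᵘ (+ m) 0))
               (ℚᵘ.<-respʳ-≃ (ℚ.toℚᵘ-fromℚᵘ (ℚᵘ.mkℚᵘ (+ n) 0)) (ℚ.toℚᵘ-mono-< m<n)))))
  where
  subst₂′ : ∀ {a b c d} → a ≡ b → c ≡ d → a ℤ.< c → b ℤ.< d
  subst₂′ refl refl lt = lt

archimedean : ∀ q → ∃ λ n → q ℚ.≤ (+ n ℚ./ 1)
archimedean q@(mkℚ i d-1 _) = ℤ.∣ i ∣ , ℚ.toℚᵘ-cancel-≤
  (ℚᵘ.≤-respʳ-≃ (ℚᵘ.≃-sym (ℚ.toℚᵘ-fromℚᵘ (ℚᵘ.mkℚᵘ (+ ℤ.∣ i ∣) 0))) (ℚᵘ.*≤* (bound i)))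
  where
  bound : ∀ i → i ℤ.* + 1 ℤ.≤ + ℤ.∣ i ∣ ℤ.* + suc d-1
  bound (+ n) rewrite ℤ.*-identityʳ (+ n) | sym (ℤ.pos-* n (suc d-1)) =
    ℤ.+≤+ (ℕ.m≤m*n n (suc d-1))
  bound -[1+ n ] = ℤ.-≤+

Eventually : (ℕ → Set) → Set
Eventually P = ∃ λ N → ∀ n → N ℕ.≤ n → P n

both : ∀ {P Q : ℕ → Set} → Eventually P → Eventually Q → Eventually (λ n → P n × Q n)
both (M , p) (N , q) = M ℕ.⊔ N , λ n ≤n →
  p n (ℕ.≤-trans (ℕ.m≤m⊔n M N) ≤n) , q n (ℕ.≤-trans (ℕ.m≤n⊔m M N) ≤n)

IsCauchy : (ℕ → ℚ) → Set
IsCauchy x = ∀ ε → 0ℚ ℚ.< ε →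
  ∃ λ N → ∀ m n → N ℕ.≤ m → N ℕ.≤ n → ℚ.∣ x m ℚ.- x n ∣ ℚ.< ε

-- No quotient is formed: several sequences represent the same real, and real
-- equality is `_≤_` in both directions. The arithmetic, the order, and the sets,
-- counts and sums defined from them respect it.
record ℝ : Set where
  constructor mkℝ
  field
    seq    : ℕ → ℚ
    cauchy : IsCauchy seq

open ℝ public

infix 4 _≤_ _<_

_≤_ : ℝ → ℝ → Set
x ≤ y = ∀ ε → 0ℚ ℚ.< ε → Eventually λ n → seq x n ℚ.≤ seq y n ℚ.+ ε

_<_ : ℝ → ℝ → Set
x < y = ∃ λ ε → 0ℚ ℚ.< ε × Eventually λ n → seq x n ℚ.+ ε ℚ.≤ seq y n

fromℚ : ℚ → ℝ
fromℚ q = mkℝ (λ _ → q) λ ε 0<ε → 0 , λ _ _ _ _ →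
  subst (λ r → ℚ.∣ r ∣ ℚ.< ε) (sym (ℚ.+-inverseʳ q)) 0<ε

fromℕ : ℕ → ℝ
fromℕ n = fromℚ (+ n ℚ./ 1)

0ℝ 1ℝ : ℝ
0ℝ = fromℕ 0
1ℝ = fromℕ 1

bounded : ∀ x → ∃ λ B → 0ℚ ℚ.< B × Eventually λ n → ℚ.∣ seq x n ∣ ℚ.≤ B
bounded x with cauchy x 1ℚ 0<1
... | N , close = ℚ.∣ seq x N ∣ ℚ.+ 1ℚ
  , ℚ.+-mono-≤-< (ℚ.0≤∣p∣ (seq x N)) 0<1
  , N , λ n N≤n → ℚ.≤-trans (∣p∣≤∣q∣+∣p-q∣ (seq x n) (seq x N))
      (ℚ.+-monoʳ-≤ ℚ.∣ seq x N ∣ (ℚ.<⇒≤ (close n N N≤n ℕ.≤-refl)))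

join : ∀ {P Q : ℕ → ℕ → Set} →
  (∃ λ N → ∀ m n → N ℕ.≤ m → N ℕ.≤ n → P m n) →
  (∃ λ N → ∀ m n → N ℕ.≤ m → N ℕ.≤ n → Q m n) →
  ∃ λ N → ∀ m n → N ℕ.≤ m → N ℕ.≤ n → P m n × Q m n
join (M , p) (N , q) = M ℕ.⊔ N , λ m n ≤m ≤n →
  p m n (ℕ.≤-trans (ℕ.m≤m⊔n M N) ≤m) (ℕ.≤-trans (ℕ.m≤m⊔n M N) ≤n) ,
  q m n (ℕ.≤-trans (ℕ.m≤n⊔m M N) ≤m) (ℕ.≤-trans (ℕ.m≤n⊔m M N) ≤n)

recip : ∀ {p} → 0ℚ ℚ.< p → ∃ λ r → 0ℚ ℚ.< r × p ℚ.* r ≡ 1ℚ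
recip {p} 0<p = let instance _ = ℚ.positive 0<p ; _ = ℚ.pos⇒nonZero p in
  ℚ.1/ p , ℚ.positive⁻¹ (ℚ.1/ p) {{ℚ.1/pos⇒pos p}} , ℚ.*-inverseʳ p

infixl 6 _+_ _-_
infixl 7 _*_
infix  8 -_

_+_ : ℝ → ℝ → ℝ
seq    (x + y) n = seq x n ℚ.+ seq y n
cauchy (x + y) ε 0<ε =
  let N , close = join (cauchy x (½ ℚ.* ε) (0<* 0<½ 0<ε)) (cauchy y (½ ℚ.* ε) (0<* 0<½ 0<ε))
  in N , λ m n ≤m ≤n → let cx , cy = close m n ≤m ≤n in
    ℚ.≤-<-trans
      (ℚ.≤-trans
        (ℚ.≤-reflexive (cong ℚ.∣_∣ (regroup (seq x m) (seq y m) (seq x n) (seq y n))))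
        (ℚ.∣p+q∣≤∣p∣+∣q∣ (seq x m ℚ.- seq x n) (seq y m ℚ.- seq y n)))
      (subst (_ ℚ.<_) (halves ε) (ℚ.+-mono-< cx cy))
  where
  open +-*-Solver
  regroup : ∀ a b c d → (a ℚ.+ b) ℚ.- (c ℚ.+ d) ≡ (a ℚ.- c) ℚ.+ (b ℚ.- d)
  regroup = solve 4 (λ a b c d → (a :+ b) :- (c :+ d) := (a :- c) :+ (b :- d)) refl

-_ : ℝ → ℝ
seq    (- x) n = ℚ.- seq x n
cauchy (- x) ε 0<ε = let N , close = cauchy x ε 0<ε in N , λ m n ≤m ≤n →
  subst (ℚ._< ε)
    (trans (sym (ℚ.∣-p∣≡∣p∣ (seq x m ℚ.- seq x n)))
      (cong ℚ.∣_∣ (ℚ.neg-distrib-+ (seq x m) (ℚ.- seq x n))))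
    (close m n ≤m ≤n)

_-_ : ℝ → ℝ → ℝ
x - y = x + - y

∣_∣ : ℝ → ℝ
seq    ∣ x ∣ n = ℚ.∣ seq x n ∣
cauchy ∣ x ∣ ε 0<ε = let N , close = cauchy x ε 0<ε in N , λ m n ≤m ≤n →
  ℚ.≤-<-trans (∣∣p∣-∣q∣∣≤∣p-q∣ (seq x m) (seq x n)) (close m n ≤m ≤n)

_*_ : ℝ → ℝ → ℝ
seq    (x * y) n = seq x n ℚ.* seq y n
cauchy (x * y) ε 0<ε =
  let B , 0<B , Nx , x≤B = bounded x
      C , 0<C , Ny , y≤C = bounded y
      r , 0<r , [B+C]r≡1 = recip {B ℚ.+ C} (ℚ.+-mono-< 0<B 0<C)
      δ = r ℚ.* ε
      0<δ = 0<* 0<r 0<ε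
      N , close = join (join (cauchy x δ 0<δ) (cauchy y δ 0<δ))
        (join (Nx , λ m _ ≤m _ → x≤B m ≤m) (Ny , λ _ n _ ≤n → y≤C n ≤n))
  in N , λ m n ≤m ≤n →
    let (cx , cy) , xm≤B , yn≤C = close m n ≤m ≤n
        a = seq x m ; b = seq y m ; c = seq x n ; d = seq y n
    in ℚ.≤-<-trans
      (ℚ.≤-trans
        (ℚ.≤-reflexive (cong ℚ.∣_∣ (regroup a b c d)))
        (ℚ.≤-trans (ℚ.∣p+q∣≤∣p∣+∣q∣ (a ℚ.* (b ℚ.- d)) (d ℚ.* (a ℚ.- c)))
          (ℚ.+-mono-≤
            (ℚ.≤-trans (ℚ.≤-reflexive (ℚ.∣p*q∣≡∣p∣*∣q∣ a (b ℚ.- d)))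
              (ℚ.*-monoʳ-≤-nonNeg ℚ.∣ b ℚ.- d ∣ {{ℚ.∣-∣-nonNeg (b ℚ.- d)}} xm≤B))
            (ℚ.≤-trans (ℚ.≤-reflexive (ℚ.∣p*q∣≡∣p∣*∣q∣ d (a ℚ.- c)))
              (ℚ.*-monoʳ-≤-nonNeg ℚ.∣ a ℚ.- c ∣ {{ℚ.∣-∣-nonNeg (a ℚ.- c)}} yn≤C)))))
      (subst (_ ℚ.<_)
        (trans (sym (ℚ.*-distribʳ-+ δ B C))
          (trans (sym (ℚ.*-assoc (B ℚ.+ C) r ε))
            (trans (cong (ℚ._* ε) [B+C]r≡1) (ℚ.*-identityˡ ε))))
        (ℚ.+-mono-<
          (ℚ.*-monoʳ-<-pos B {{ℚ.positive 0<B}} cy)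
          (ℚ.*-monoʳ-<-pos C {{ℚ.positive 0<C}} cx)))
  where
  open +-*-Solver
  regroup : ∀ a b c d → a ℚ.* b ℚ.- c ℚ.* d ≡ a ℚ.* (b ℚ.- d) ℚ.+ d ℚ.* (a ℚ.- c)
  regroup = solve 4 (λ a b c d → a :* b :- c :* d := a :* (b :- d) :+ d :* (a :- c)) refl

-- Reciprocal of a rational, with value 0 at 0.
inv : ℚ → ℚ
inv q with q ℚ.≟ 0ℚ
... | yes _   = 0ℚ
... | no q≢0 = (ℚ.1/ q) {{ℚ.≢-nonZero q≢0}}

*-inv : ∀ q → q ≢ 0ℚ → q ℚ.* inv q ≡ 1ℚ
*-inv q q≢0 with q ℚ.≟ 0ℚ
... | yes q≡0 = ⊥-elim (q≢0 q≡0)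
... | no q≢0′ = ℚ.*-inverseʳ q {{ℚ.≢-nonZero q≢0′}}

reciprocal : (x : ℝ) → 0ℝ < ∣ x ∣ → ℝ
seq    (reciprocal x x#0) n = inv (seq x n)
cauchy (reciprocal x (δ , 0<δ , M , far)) ε 0<ε =
  let N , close = join (cauchy x (ε ℚ.* (δ ℚ.* δ)) (0<* 0<ε (0<* 0<δ 0<δ)))
                       (M , λ m n ≤m ≤n → far′ m ≤m , far′ n ≤n)
  in N , λ m n ≤m ≤n →
    let c , δ≤a , δ≤b = close m n ≤m ≤n
        a = seq x m ; b = seq x n
    in bound a b δ≤a δ≤b c
  where
  far′ : ∀ n → M ℕ.≤ n → δ ℚ.≤ ℚ.∣ seq x n ∣
  far′ n ≤n = subst (ℚ._≤ ℚ.∣ seq x n ∣) (ℚ.+-identityˡ δ) (far n ≤n)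

  nonzero : ∀ {a} → δ ℚ.≤ ℚ.∣ a ∣ → a ≢ 0ℚ
  nonzero δ≤a refl = ℚ.<-irrefl refl (ℚ.<-≤-trans 0<δ δ≤a)

  bound : ∀ a b → δ ℚ.≤ ℚ.∣ a ∣ → δ ℚ.≤ ℚ.∣ b ∣ → ℚ.∣ a ℚ.- b ∣ ℚ.< ε ℚ.* (δ ℚ.* δ) →
          ℚ.∣ inv a ℚ.- inv b ∣ ℚ.< ε
  bound a b δ≤a δ≤b c = ℚ.*-cancelʳ-<-nonNeg (δ ℚ.* δ) {{ℚ.nonNegative (ℚ.<⇒≤ (0<* 0<δ 0<δ))}}
    (ℚ.≤-<-trans
      (ℚ.*-monoˡ-≤-nonNeg d {{ℚ.∣-∣-nonNeg (inv a ℚ.- inv b)}}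
        (*-mono-nonNeg (ℚ.<⇒≤ 0<δ) (ℚ.0≤∣p∣ a) δ≤a δ≤b))
      (ℚ.≤-<-trans (ℚ.≤-reflexive clear) c))
    where
    open +-*-Solver
    d = ℚ.∣ inv a ℚ.- inv b ∣
    clear : d ℚ.* (ℚ.∣ a ∣ ℚ.* ℚ.∣ b ∣) ≡ ℚ.∣ a ℚ.- b ∣
    clear = trans (cong (d ℚ.*_) (sym (ℚ.∣p*q∣≡∣p∣*∣q∣ a b)))
      (trans (sym (ℚ.∣p*q∣≡∣p∣*∣q∣ (inv a ℚ.- inv b) (a ℚ.* b)))
        (trans (cong ℚ.∣_∣ (trans
          (solve 4 (λ a b i j → (i :- j) :* (a :* b) := b :* (a :* i) :- a :* (b :* j)) refl
            a b (inv a) (inv b))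
          (cong₂ (λ s t → b ℚ.* s ℚ.- a ℚ.* t) (*-inv a (nonzero δ≤a)) (*-inv b (nonzero δ≤b)))))
        (trans (cong ℚ.∣_∣ (cong₂ ℚ._-_ (ℚ.*-identityʳ b) (ℚ.*-identityʳ a)))
          (∣p-q∣≡∣q-p∣ b a))))

bound : ℝ → ℕ
bound x = proj₁ (archimedean (proj₁ (bounded x)))

<bound : ∀ {n} x → fromℕ n < x → n ℕ.< bound x
<bound {n} x (ε , 0<ε , n+ε≤x) =
  let B , _ , x≤B = bounded x
      _ , B≤⌈B⌉ = archimedean B
      N , both-at = both n+ε≤x x≤B
      n+ε≤xN , xN≤B = both-at N ℕ.≤-refl
  in /1-cancel-< (ℚ.<-≤-trans
    (ℚ.<-≤-trans
      (subst (ℚ._< (+ n ℚ./ 1) ℚ.+ ε) (ℚ.+-identityʳ (+ n ℚ./ 1)) (ℚ.+-monoʳ-< (+ n ℚ./ 1) 0<ε))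
      n+ε≤xN)
    (ℚ.≤-trans (p≤∣p∣ (seq x N)) (ℚ.≤-trans xN≤B B≤⌈B⌉)))

T : Pred ℝ 0ℓ
T x = (0ℝ < x × x ≤ 1ℝ)
    ⊎ ∃ λ k → ¬ (2 ∣ k) × 3 ℕ.≤ k × fromℕ k - 1ℝ ≤ x × x ≤ fromℕ k

𝒰 : Pred (ℝ × ℝ) 0ℓ
𝒰 (x₁ , x₂) = T x₁ × T x₂ × ∣ x₁ - x₂ ∣ ≤ 1ℝ

record FinSet⁺ : Set where
  field
    elements : List ℕ
    unique   : Unique elements
    positive : All (0 ℕ.<_) elements

open FinSet⁺ public

infix 10 _⟨_⟩

times∈? : ∀ a d (𝒜 : FinSet⁺) → Dec (a ℕ.* d ∈ elements 𝒜)
times∈? a d 𝒜 = mem? ℕ._≟_ (a ℕ.* d) (elements 𝒜)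

-- 𝒜 ⟨ d ⟩ is {a : a d ∈ 𝒜}; for d = 0 it is empty, since 0 ∉ 𝒜.
_⟨_⟩ : FinSet⁺ → ℕ → FinSet⁺
elements (𝒜 ⟨ d ⟩) = filter (λ a → times∈? a d 𝒜) (upTo (suc (max 0 (elements 𝒜))))
unique   (𝒜 ⟨ d ⟩) = Unique.filter⁺ (λ a → times∈? a d 𝒜) (Unique.upTo⁺ (suc (max 0 (elements 𝒜))))
positive (𝒜 ⟨ d ⟩) = All.tabulate λ {a} a∈ → factor a (All.lookup (positive 𝒜)
  (proj₂ (∈-filter⁻ (λ a → times∈? a d 𝒜) {xs = upTo (suc (max 0 (elements 𝒜)))} a∈)))
  where
  factor : ∀ a → 0 ℕ.< a ℕ.* d → 0 ℕ.< a
  factor (suc a) _ = s≤s z≤n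

-- The search range in the definition of 𝒜 ⟨ d ⟩ misses nothing.
∈-⟨⟩ : ∀ 𝒜 d a → a ∈ elements (𝒜 ⟨ d ⟩) ⇔ a ℕ.* d ∈ elements 𝒜
∈-⟨⟩ 𝒜 d a = mk⇔
  (λ a∈ → proj₂ (∈-filter⁻ (λ a → times∈? a d 𝒜) {xs = upTo (suc (max 0 (elements 𝒜)))} a∈))
  (λ ad∈ → ∈-filter⁺ (λ a → times∈? a d 𝒜) (∈-upTo⁺ (s≤s (small d ad∈))) ad∈)
  where
  small : ∀ d → a ℕ.* d ∈ elements 𝒜 → a ℕ.≤ max 0 (elements 𝒜)
  small zero ad∈ with () ← subst (0 ℕ.<_) (ℕ.*-zeroʳ a) (All.lookup (positive 𝒜) ad∈)
  small (suc d) ad∈ =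
    ℕ.≤-trans (ℕ.m≤m*n a (suc d)) (All.lookup (xs≤max 0 (elements 𝒜)) ad∈)

∑ : List ℕ → (ℕ → ℕ) → ℕ
∑ ns f = sum (map f ns)

infix 5 ∑
syntax ∑ ns (λ n → e) = ∑[ n ∈ ns ] e

-- Comparisons of reals are undecidable constructively, so counting the
-- elements of a set cut out by a real parameter uses excluded middle.
module Classical (em : ExcludedMiddle 0ℓ) where

  infixl 7 _/_

  -- x / y is 0 when y is zero.
  _/_ : ℝ → ℝ → ℝ
  x / y with em {0ℝ < ∣ y ∣}
  ... | yes y#0 = x * reciprocal y y#0
  ... | no _    = 0ℝ

  NoPrimeFactorBelow : ℝ → ℕ → Set
  NoPrimeFactorBelow z a = ¬ ∃ λ p → Prime p × p ∣ a × fromℕ p < z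

  S : FinSet⁺ → ℝ → ℕ
  S 𝒜 z = length (filter (λ a → em {NoPrimeFactorBelow z a}) (elements 𝒜))

  PrimeIn : ℝ → ℝ → ℕ → Set
  PrimeIn w z p = Prime p × w ≤ fromℕ p × fromℕ p < z

  primeIn? : ∀ w z p → Dec (PrimeIn w z p)
  primeIn? w z p = prime? p ×-dec (em ×-dec em)

  primesIn : ℝ → ℝ → List ℕ
  primesIn w z = filter (primeIn? w z) (upTo (bound z))

  -- The search range in the definition of primesIn misses nothing.
  ∈-primesIn : ∀ w z p → p ∈ primesIn w z ⇔ PrimeIn w z p
  ∈-primesIn w z p = mk⇔
    (λ p∈ → proj₂ (∈-filter⁻ (primeIn? w z) {xs = upTo (bound z)} p∈))
    (λ { h@(_ , _ , p<z) → ∈-filter⁺ (primeIn? w z) (∈-upTo⁺ (<bound z p<z)) h })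

{-# OPTIONS --safe #-}

-- Let ν(a) be the number of primes of [w, z) dividing a. For d with no prime factor below w,
-- S(𝒜_d, w) counts the multiples of d among the w-sifted elements of 𝒜, so after multiplication by
-- m₁ m₂ the right-hand side is the sum over the w-sifted a of
--   m₁ m₂ - (m₁ + m₂ - 1) ν(a) + ν(a) (ν(a) - 1) = (ν(a) - m₁) (ν(a) - m₂).
-- The terms with ν(a) = 0 are m₁ m₂ and account for S(𝒜, z); the others are nonnegative because the
-- condition (m₁, m₂) ∈ 𝒰 leaves no integer strictly between m₁ and m₂.
module Submission where

open import Defs
open import Axiom.ExcludedMiddle using (ExcludedMiddle)
open import Data.Empty using (⊥)
open import Data.Integer.Base as ℤ using (+_)
import Data.Integer.Properties as ℤ
open import Data.List.Base using (List; []; _∷_; filter; length; map)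
open import Data.List.Properties using (map-cong-local; length-map; filter-none; filter-accept)
import Data.List.Membership.Propositional as List
open import Data.List.Membership.Propositional.Properties using (∈-map⁺; ∈-map⁻; ∈-filter⁺; ∈-filter⁻)
open import Data.List.Membership.Propositional.Properties.WithK using (unique∧set⇒bag)
open import Data.List.Relation.Binary.BagAndSetEquality using (∼bag⇒↭)
open import Data.List.Relation.Binary.Permutation.Propositional.Properties using (↭-length)
open import Data.List.Relation.Unary.All as All using (_∷_)
open import Data.List.Relation.Unary.AllPairs using (AllPairs; []; _∷_)
import Data.List.Relation.Unary.AllPairs.Properties as AllPairs
import Data.List.Relation.Unary.Unique.Propositional.Properties as Unique
open import Data.Nat.Base as ℕ using (ℕ; zero; suc; z≤n; s≤s; NonZero)
open import Data.Nat.Divisibility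
  using (_∣_; divides; _∣?_; _∣0; ∣-refl; ∣-trans; ∣m∣n⇒∣m+n; m∣m*n; n∣m*n)
open import Data.Nat.ListAction using (sum)
open import Data.Nat.Primality using (Prime; euclidsLemma; prime⇒irreducible; prime⇒nonZero)
import Data.Nat.Properties as ℕ
open import Data.Nat.Properties using (_<?_)
import Data.Nat.Solver as ℕ
open import Data.Product using (∃; _×_; _,_; proj₁; proj₂; map₂)
open import Data.Rational.Base as ℚ using (ℚ; 0ℚ; 1ℚ; ½)
import Data.Rational.Properties as ℚ
import Data.Rational.Solver as ℚ
import Data.Rational.Unnormalised.Base as ℚᵘ
import Data.Rational.Unnormalised.Properties as ℚᵘ
open import Data.Sum.Base using (_⊎_; inj₁; inj₂; [_,_]′)
open import Function.Base using (_∘_; id)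
open import Function.Bundles using (mk⇔; Equivalence)
open import Level using (0ℓ)
open import Relation.Binary.Definitions using (tri<; tri≈; tri>)
open import Relation.Binary.PropositionalEquality
  using (_≡_; _≢_; refl; sym; trans; cong; cong₂; subst; subst₂; module ≡-Reasoning)
open import Relation.Nullary using (¬_; Dec; yes; no; contradiction)
open import Relation.Unary using (Pred; Decidable; _∈_)

-- The embedding of the natural numbers in the rationals.

ι : ℕ → ℚ
ι n = + n ℚ./ 1

ι-toℚᵘ : ∀ n → ℚ.toℚᵘ (ι n) ℚᵘ.≃ ℚᵘ.mkℚᵘ (+ n) 0
ι-toℚᵘ n = ℚ.toℚᵘ-fromℚᵘ (ℚᵘ.mkℚᵘ (+ n) 0)

ι-+ : ∀ m n → ι (m ℕ.+ n) ≡ ι m ℚ.+ ι n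
ι-+ m n = ℚ.toℚᵘ-injective (ℚᵘ.≃-trans (ι-toℚᵘ (m ℕ.+ n)) (ℚᵘ.≃-sym (ℚᵘ.≃-trans
  (ℚ.toℚᵘ-homo-+ (ι m) (ι n))
  (ℚᵘ.≃-trans (ℚᵘ.+-cong (ι-toℚᵘ m) (ι-toℚᵘ n))
    (ℚᵘ.*≡* (cong (ℤ._* + 1)
      (cong₂ ℤ._+_ (ℤ.*-identityʳ (+ m)) (ℤ.*-identityʳ (+ n)))))))))

ι-* : ∀ m n → ι (m ℕ.* n) ≡ ι m ℚ.* ι n
ι-* m n = ℚ.toℚᵘ-injective (ℚᵘ.≃-trans (ι-toℚᵘ (m ℕ.* n)) (ℚᵘ.≃-sym (ℚᵘ.≃-trans
  (ℚ.toℚᵘ-homo-* (ι m) (ι n))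
  (ℚᵘ.≃-trans (ℚᵘ.*-cong (ι-toℚᵘ m) (ι-toℚᵘ n))
    (ℚᵘ.*≡* (cong (ℤ._* + 1) (sym (ℤ.pos-* m n))))))))

0≤ι : ∀ n → 0ℚ ℚ.≤ ι n
0≤ι n = ℚ.nonNegative⁻¹ (ι n) {{ℚ.normalize-nonNeg n 1}}

ι-mono-≤ : ∀ {m n} → m ℕ.≤ n → ι m ℚ.≤ ι n
ι-mono-≤ {m} {n} m≤n = subst₂ ℚ._≤_ (ℚ.+-identityʳ (ι m))
  (trans (sym (ι-+ m (n ℕ.∸ m))) (cong ι (ℕ.m+[n∸m]≡n m≤n)))
  (ℚ.+-monoʳ-≤ (ι m) (0≤ι (n ℕ.∸ m)))

-- Order and signs of Cauchy reals.

p≤p+q : ∀ p {q} → 0ℚ ℚ.≤ q → p ℚ.≤ p ℚ.+ q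
p≤p+q p {q} 0≤q = subst (ℚ._≤ p ℚ.+ q) (ℚ.+-identityʳ p) (ℚ.+-monoʳ-≤ p 0≤q)

eventually-≤⇒≤ : ∀ x y → Eventually (λ n → seq x n ℚ.≤ seq y n) → x ≤ y
eventually-≤⇒≤ x y (N , xₙ≤yₙ) ε 0<ε = N , λ n ≤n →
  ℚ.≤-trans (xₙ≤yₙ n ≤n) (p≤p+q (seq y n) (ℚ.<⇒≤ 0<ε))

-- The substitute for real equality, there being no quotient: a ring identity is checked on the
-- rational terms and enters a chain of `_≤_` through this lemma.
pointwise⇒≤ : ∀ x y → (∀ n → seq x n ≡ seq y n) → x ≤ y
pointwise⇒≤ x y eq = eventually-≤⇒≤ x y (0 , λ n _ → ℚ.≤-reflexive (eq n))

≤-trans : ∀ x y z → x ≤ y → y ≤ z → x ≤ z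
≤-trans x y z x≤y y≤z ε 0<ε =
  let N , h = both (x≤y (½ ℚ.* ε) (0<* 0<½ 0<ε)) (y≤z (½ ℚ.* ε) (0<* 0<½ 0<ε))
  in N , λ n ≤n → let xy , yz = h n ≤n in
    ℚ.≤-trans xy (ℚ.≤-trans (ℚ.+-monoˡ-≤ (½ ℚ.* ε) yz)
      (ℚ.≤-reflexive (trans (ℚ.+-assoc (seq z n) _ _) (cong (seq z n ℚ.+_) (halves ε)))))

+-mono-≤ : ∀ x y u v → x ≤ y → u ≤ v → x + u ≤ y + v
+-mono-≤ x y u v x≤y u≤v ε 0<ε =
  let N , h = both (x≤y (½ ℚ.* ε) (0<* 0<½ 0<ε)) (u≤v (½ ℚ.* ε) (0<* 0<½ 0<ε))
  in N , λ n ≤n → let xy , uv = h n ≤n in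
    ℚ.≤-trans (ℚ.+-mono-≤ xy uv) (ℚ.≤-reflexive (trans
      (solve 3 (λ a b e → (a :+ e) :+ (b :+ e) := (a :+ b) :+ (e :+ e)) refl
        (seq y n) (seq v n) (½ ℚ.* ε))
      (cong ((seq y n ℚ.+ seq v n) ℚ.+_) (halves ε))))
  where open ℚ.+-*-Solver

<-≤-trans : ∀ x y z → x < y → y ≤ z → x < z
<-≤-trans x y z (ε , 0<ε , x<y) y≤z =
  let N , h = both x<y (y≤z (½ ℚ.* ε) (0<* 0<½ 0<ε))
  -- Half of the gap `ε` absorbs the slack of `y≤z`; the other half survives as the gap between `x`
  -- and `z`.
  in ½ ℚ.* ε , 0<* 0<½ 0<ε , N , λ n ≤n → let xy , yz = h n ≤n in
    subst₂ ℚ._≤_ (cancel (seq x n)) (shift (seq z n))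
      (ℚ.+-monoˡ-≤ (ℚ.- (½ ℚ.* ε)) (ℚ.≤-trans xy yz))
  where
  open ℚ.+-*-Solver
  shift : ∀ a → a ℚ.+ ½ ℚ.* ε ℚ.- ½ ℚ.* ε ≡ a
  shift a = solve 2 (λ a e → a :+ e :- e := a) refl a (½ ℚ.* ε)
  cancel : ∀ a → a ℚ.+ ε ℚ.- ½ ℚ.* ε ≡ a ℚ.+ ½ ℚ.* ε
  cancel a = trans (cong (λ e → a ℚ.+ e ℚ.- ½ ℚ.* ε) (sym (halves ε)))
    (solve 2 (λ a e → a :+ (e :+ e) :- e := a :+ e) refl a (½ ℚ.* ε))

<-irrefl : ∀ x → ¬ x < x
<-irrefl x (ε , 0<ε , N , h) = ℚ.<-irrefl refl (ℚ.<-≤-trans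
  (subst (ℚ._< seq x N ℚ.+ ε) (ℚ.+-identityʳ (seq x N)) (ℚ.+-monoʳ-< (seq x N) 0<ε))
  (h N ℕ.≤-refl))

<⇒≤ : ∀ x y → x < y → x ≤ y
<⇒≤ x y (ε , 0<ε , N , h) = eventually-≤⇒≤ x y (N , λ n ≤n →
  ℚ.≤-trans (p≤p+q (seq x n) (ℚ.<⇒≤ 0<ε)) (h n ≤n))

fromℕ-mono-≤ : ∀ {m n} → m ℕ.≤ n → fromℕ m ≤ fromℕ n
fromℕ-mono-≤ {m} {n} m≤n = eventually-≤⇒≤ (fromℕ m) (fromℕ n) (0 , λ _ _ → ι-mono-≤ m≤n)

p≤q⇒0≤q-p : ∀ {p q} → p ℚ.≤ q → 0ℚ ℚ.≤ q ℚ.- p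
p≤q⇒0≤q-p {p} {q} p≤q = subst (ℚ._≤ q ℚ.- p) (ℚ.+-inverseʳ p) (ℚ.+-monoˡ-≤ (ℚ.- p) p≤q)

0<⊓ : ∀ {p q} → 0ℚ ℚ.< p → 0ℚ ℚ.< q → 0ℚ ℚ.< p ℚ.⊓ q
0<⊓ {p} {q} 0<p 0<q with ℚ.⊓-sel p q
... | inj₁ eq = subst (0ℚ ℚ.<_) (sym eq) 0<p
... | inj₂ eq = subst (0ℚ ℚ.<_) (sym eq) 0<q

0≤* : ∀ {p q} → 0ℚ ℚ.≤ p → 0ℚ ℚ.≤ q → 0ℚ ℚ.≤ p ℚ.* q
0≤* {p} {q} 0≤p 0≤q = subst (ℚ._≤ p ℚ.* q) (ℚ.*-zeroˡ 0ℚ) (*-mono-nonNeg ℚ.≤-refl 0≤p 0≤p 0≤q)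

x≤y⇒0≤y-x : ∀ x y → x ≤ y → 0ℝ ≤ y - x
x≤y⇒0≤y-x x y x≤y ε 0<ε = let N , h = x≤y ε 0<ε in N , λ n ≤n →
  subst (0ℚ ℚ.≤_) (solve 3 (λ x y e → (y :+ e) :- x := (y :- x) :+ e) refl (seq x n) (seq y n) ε)
    (p≤q⇒0≤q-p (h n ≤n))
  where open ℚ.+-*-Solver

-- From u, v ≥ -δ one gets u v ≥ -δ (u + v + δ), so δ is chosen with δ (B + C + 1) ≤ ε and δ ≤ 1,
-- where B and C bound ∣u∣ and ∣v∣.
0≤x*y : ∀ x y → 0ℝ ≤ x → 0ℝ ≤ y → 0ℝ ≤ x * y
0≤x*y x y 0≤x 0≤y ε 0<ε =
  let B , 0<B , x≤B = bounded x
      C , 0<C , y≤C = bounded y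
      0<D = ℚ.+-mono-< (ℚ.+-mono-< 0<B 0<C) 0<1
      D = B ℚ.+ C ℚ.+ 1ℚ
      r , 0<r , Dr≡1 = recip {D} 0<D
      δ = (r ℚ.* ε) ℚ.⊓ 1ℚ
      0<δ = 0<⊓ (0<* 0<r 0<ε) 0<1
      N , h = both (both x≤B y≤C) (both (0≤x δ 0<δ) (0≤y δ 0<δ))
  in N , λ n ≤n →
    let (u≤B , v≤C) , 0≤u+δ , 0≤v+δ = h n ≤n
        u = seq x n ; v = seq y n
        δ≤rε = ℚ.p⊓q≤p (r ℚ.* ε) 1ℚ
        δ≤1 = ℚ.p⊓q≤q (r ℚ.* ε) 1ℚ
        sum≤D : u ℚ.+ v ℚ.+ δ ℚ.≤ D
        sum≤D = ℚ.+-mono-≤ (ℚ.+-mono-≤ (ℚ.≤-trans (p≤∣p∣ u) u≤B) (ℚ.≤-trans (p≤∣p∣ v) v≤C)) δ≤1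
        small : (u ℚ.+ v ℚ.+ δ) ℚ.* δ ℚ.≤ ε
        small = ℚ.≤-trans (*-mono-nonNeg (ℚ.<⇒≤ 0<δ) (ℚ.<⇒≤ 0<D) sum≤D δ≤rε)
          (ℚ.≤-reflexive (trans (sym (ℚ.*-assoc D r ε))
            (trans (cong (ℚ._* ε) Dr≡1) (ℚ.*-identityˡ ε))))
    in ℚ.≤-trans (0≤* 0≤u+δ 0≤v+δ) (ℚ.≤-trans
      (ℚ.≤-reflexive (solve 3 (λ u v d → (u :+ d) :* (v :+ d) := u :* v :+ (u :+ v :+ d) :* d)
        refl u v δ))
      (ℚ.+-monoʳ-≤ (u ℚ.* v) small))
  where
  open ℚ.+-*-Solver

0<x*y : ∀ x y → 0ℝ < x → 0ℝ < y → 0ℝ < x * y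
0<x*y x y (δ , 0<δ , x>δ) (η , 0<η , y>η) =
  let N , h = both x>δ y>η in
  δ ℚ.* η , 0<* 0<δ 0<η , N , λ n ≤n → let δ≤x , η≤y = h n ≤n in
    subst (ℚ._≤ seq x n ℚ.* seq y n) (sym (ℚ.+-identityˡ (δ ℚ.* η)))
      (*-mono-nonNeg (ℚ.<⇒≤ 0<η) (ℚ.≤-trans (ℚ.<⇒≤ 0<δ) (drop δ δ≤x)) (drop δ δ≤x) (drop η η≤y))
  where
  drop : ∀ p {q} → 0ℚ ℚ.+ p ℚ.≤ q → p ℚ.≤ q
  drop p = subst (ℚ._≤ _) (ℚ.+-identityˡ p)

x≤∣x∣ : ∀ x → x ≤ ∣ x ∣
x≤∣x∣ x = eventually-≤⇒≤ x ∣ x ∣ (0 , λ n _ → p≤∣p∣ (seq x n))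

0<x⇒0<xₙ : ∀ x → 0ℝ < x → Eventually λ n → 0ℚ ℚ.< seq x n
0<x⇒0<xₙ x (δ , 0<δ , N , h) = N , λ n ≤n →
  ℚ.<-≤-trans 0<δ (subst (ℚ._≤ seq x n) (ℚ.+-identityˡ δ) (h n ≤n))

0≤inv : ∀ {q} → 0ℚ ℚ.< q → 0ℚ ℚ.≤ inv q
0≤inv {q} 0<q with q ℚ.≟ 0ℚ
... | yes _ = ℚ.≤-refl
... | no q≢0 = ℚ.<⇒≤ (ℚ.positive⁻¹ _ {{ℚ.1/pos⇒pos q {{ℚ.positive 0<q}}}})

-- Finite sums over lists.

∑-cong : ∀ ns {f g : ℕ → ℕ} → (∀ {n} → n List.∈ ns → f n ≡ g n) → ∑ ns f ≡ ∑ ns g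
∑-cong ns f≡g = cong sum (map-cong-local (All.tabulate f≡g))

∑-zero : ∀ ns → ∑ ns (λ _ → 0) ≡ 0
∑-zero []       = refl
∑-zero (_ ∷ ns) = ∑-zero ns

∑-distrib-+ : ∀ ns (f g : ℕ → ℕ) → ∑ ns (λ n → f n ℕ.+ g n) ≡ ∑ ns f ℕ.+ ∑ ns g
∑-distrib-+ []       f g = refl
∑-distrib-+ (n ∷ ns) f g = trans (cong (f n ℕ.+ g n ℕ.+_) (∑-distrib-+ ns f g))
  (solve 4 (λ a b c d → a :+ b :+ (c :+ d) := a :+ c :+ (b :+ d)) refl (f n) (g n) (∑ ns f) (∑ ns g))
  where open ℕ.+-*-Solver

∑-*-distribʳ : ∀ ns (f : ℕ → ℕ) c → ∑ ns (λ n → f n ℕ.* c) ≡ ∑ ns f ℕ.* c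
∑-*-distribʳ []       f c = refl
∑-*-distribʳ (n ∷ ns) f c =
  trans (cong (f n ℕ.* c ℕ.+_) (∑-*-distribʳ ns f c)) (sym (ℕ.*-distribʳ-+ c (f n) (∑ ns f)))

∑-comm : ∀ ms ns (f : ℕ → ℕ → ℕ) → (∑[ m ∈ ms ] ∑[ n ∈ ns ] f m n) ≡ (∑[ n ∈ ns ] ∑[ m ∈ ms ] f m n)
∑-comm []       ns f = sym (∑-zero ns)
∑-comm (m ∷ ms) ns f = trans (cong (∑ ns (f m) ℕ.+_) (∑-comm ms ns f))
  (sym (∑-distrib-+ ns (f m) (λ n → ∑[ m ∈ ms ] f m n)))

-- The square of a sum splits into its diagonal and twice the part below the diagonal. Sortedness
-- makes the head `k` the least entry, so adding it creates exactly the pairs `(m , k)` with `m` in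
-- the tail, of total `F * f k`. With `f` an indicator this becomes the count of pairs of prime
-- divisors.
∑-below : ∀ {ns} → AllPairs ℕ._<_ ns → (f : ℕ → ℕ) →
  2 ℕ.* (∑[ m ∈ ns ] ∑[ n ∈ filter (ℕ._<? m) ns ] f m ℕ.* f n) ℕ.+ (∑[ n ∈ ns ] f n ℕ.* f n)
    ≡ ∑ ns f ℕ.* ∑ ns f
∑-below []                      f = refl
∑-below {k ∷ ns} (k<ns ∷ sorted) f = begin
  2 ℕ.* (below k (k ∷ ns) ℕ.+ (∑[ m ∈ ns ] below m (k ∷ ns))) ℕ.+ (f k ℕ.* f k ℕ.+ squares)
    ≡⟨ cong₂ (λ a b → 2 ℕ.* (a ℕ.+ b) ℕ.+ (f k ℕ.* f k ℕ.+ squares)) none split ⟩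
  2 ℕ.* (F ℕ.* f k ℕ.+ inner) ℕ.+ (f k ℕ.* f k ℕ.+ squares)
    ≡⟨ solve 4 (λ a F i s → con 2 :* (F :* a :+ i) :+ (a :* a :+ s)
                 := (con 2 :* i :+ s) :+ (a :* a :+ con 2 :* a :* F)) refl (f k) F inner squares ⟩
  (2 ℕ.* inner ℕ.+ squares) ℕ.+ (f k ℕ.* f k ℕ.+ 2 ℕ.* f k ℕ.* F)
    ≡⟨ cong (ℕ._+ (f k ℕ.* f k ℕ.+ 2 ℕ.* f k ℕ.* F)) (∑-below sorted f) ⟩
  F ℕ.* F ℕ.+ (f k ℕ.* f k ℕ.+ 2 ℕ.* f k ℕ.* F)
    ≡⟨ solve 2 (λ a F → F :* F :+ (a :* a :+ con 2 :* a :* F) := (a :+ F) :* (a :+ F)) refl (f k) F ⟩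
  (f k ℕ.+ F) ℕ.* (f k ℕ.+ F) ∎
  where
  open ≡-Reasoning
  open ℕ.+-*-Solver
  F = ∑ ns f
  squares = ∑[ n ∈ ns ] f n ℕ.* f n
  below : ℕ → List ℕ → ℕ
  below m ms = ∑[ n ∈ filter (ℕ._<? m) ms ] f m ℕ.* f n
  inner = ∑[ m ∈ ns ] below m ns
  none : below k (k ∷ ns) ≡ 0
  none = cong (λ ms → ∑[ n ∈ ms ] f k ℕ.* f n)
    (filter-none (ℕ._<? k) {xs = k ∷ ns} (ℕ.<-irrefl refl ∷ All.map ℕ.<-asym k<ns))
  -- Every `m` of the tail exceeds `k`, so `k` passes the filter and heads the list below `m`.
  split : (∑[ m ∈ ns ] below m (k ∷ ns)) ≡ F ℕ.* f k ℕ.+ inner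
  split = begin
    (∑[ m ∈ ns ] below m (k ∷ ns))
      ≡⟨ ∑-cong ns (λ {m} m∈ → cong (λ ms → ∑[ n ∈ ms ] f m ℕ.* f n)
           (filter-accept (ℕ._<? m) {xs = ns} (All.lookup k<ns m∈))) ⟩
    (∑[ m ∈ ns ] (f m ℕ.* f k ℕ.+ below m ns))
      ≡⟨ ∑-distrib-+ ns (λ m → f m ℕ.* f k) (λ m → below m ns) ⟩
    (∑[ m ∈ ns ] f m ℕ.* f k) ℕ.+ inner
      ≡⟨ cong (ℕ._+ inner) (∑-*-distribʳ ns f (f k)) ⟩
    F ℕ.* f k ℕ.+ inner ∎

-- Indicators and counting.

𝟙 : {P : Set} → Dec P → ℕ
𝟙 (yes _) = 1
𝟙 (no _)  = 0

𝟙-yes : {P : Set} (P? : Dec P) → P → 𝟙 P? ≡ 1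
𝟙-yes (yes _) _ = refl
𝟙-yes (no ¬p) p = contradiction p ¬p

𝟙-no : {P : Set} (P? : Dec P) → ¬ P → 𝟙 P? ≡ 0
𝟙-no (yes p) ¬p = contradiction p ¬p
𝟙-no (no _)  _  = refl

𝟙-idem : {P : Set} (P? : Dec P) → 𝟙 P? ℕ.* 𝟙 P? ≡ 𝟙 P?
𝟙-idem (yes _) = refl
𝟙-idem (no _)  = refl

𝟙-× : {P Q R : Set} (P? : Dec P) (Q? : Dec Q) (R? : Dec R) →
  (P → Q × R) → (Q → R → P) → 𝟙 P? ≡ 𝟙 Q? ℕ.* 𝟙 R?
𝟙-× P? (no ¬q) _       f _ = 𝟙-no P? (¬q ∘ proj₁ ∘ f)
𝟙-× P? (yes _) (no ¬r) f _ = 𝟙-no P? (¬r ∘ proj₂ ∘ f)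
𝟙-× P? (yes q) (yes r) _ g = 𝟙-yes P? (g q r)

length-filter≡∑ : {P : Pred ℕ 0ℓ} (P? : Decidable P) → ∀ ns → length (filter P? ns) ≡ (∑[ n ∈ ns ] 𝟙 (P? n))
length-filter≡∑ P? []       = refl
length-filter≡∑ P? (n ∷ ns) with P? n
... | yes _ = cong suc (length-filter≡∑ P? ns)
... | no _  = length-filter≡∑ P? ns

-- Entries satisfying `P` also satisfy `Q` and carry `g = 0`, so they are counted once on each side;
-- any other entry satisfying `Q` adds `g n`, at most 1, on the left and 1 on the right.
length-filter-⊆ : {P Q : Pred ℕ 0ℓ} (P? : Decidable P) (Q? : Decidable Q) (g : ℕ → ℕ) →
  (∀ {n} → P n → Q n × g n ≡ 0) → (∀ n → g n ℕ.≤ 1) →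
  ∀ ns → length (filter P? ns) ℕ.+ ∑ (filter Q? ns) g ℕ.≤ length (filter Q? ns)
length-filter-⊆ P? Q? g P⇒ g≤1 [] = z≤n
length-filter-⊆ P? Q? g P⇒ g≤1 (n ∷ ns) with P? n | Q? n | length-filter-⊆ P? Q? g P⇒ g≤1 ns
... | yes p | yes _ | ih rewrite proj₂ (P⇒ p) = s≤s ih
... | yes p | no ¬q | ih = contradiction (proj₁ (P⇒ p)) ¬q
... | no _  | yes _ | ih = ℕ.≤-trans (ℕ.≤-reflexive
    (solve 3 (λ a b c → a :+ (b :+ c) := b :+ (a :+ c)) refl (length (filter P? ns)) (g n) (∑ (filter Q? ns) g)))
  (ℕ.+-mono-≤ (g≤1 n) ih)
  where open ℕ.+-*-Solver
... | no _  | no _  | ih = ih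

-- The intervals of `T`, and integers between two points of a pair in `𝒰`.

even-or-even-suc : ∀ n → (2 ∣ n) ⊎ (2 ∣ suc n)
even-or-even-suc zero    = inj₁ (2 ∣0)
even-or-even-suc (suc n) with even-or-even-suc n
... | inj₁ 2∣n  = inj₂ (∣m∣n⇒∣m+n ∣-refl 2∣n)
... | inj₂ 2∣1+n = inj₁ 2∣1+n

-- With `[j, j + 1]` and `[k, k + 1]` intervals of `T`, the right endpoints are odd, and `k = j + 1`
-- would make them consecutive. Distinct intervals of `T` therefore never touch.
odd-gap : ∀ {j k} → ¬ 2 ∣ suc j → ¬ 2 ∣ suc k → j ℕ.< k → suc j ℕ.< k
odd-gap {j} odd-j odd-k j<k = ℕ.≤∧≢⇒< j<k λ { refl → consecutive odd-j odd-k }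
  where
  consecutive : ¬ 2 ∣ suc j → ¬ 2 ∣ suc (suc j) → ⊥
  consecutive ¬e ¬e′ with even-or-even-suc (suc j)
  ... | inj₁ e = ¬e e
  ... | inj₂ e = ¬e′ e

-- Both shapes in `T` become `[j, j + 1]` with `j + 1` odd, `(0, 1]` being the case `j = 0`. The
-- openness at 0 is kept in the separate `0ℝ < x`, which later makes `m₁ * m₂` positive.
T⇒unit-interval : ∀ x → T x →
  0ℝ < x × ∃ λ j → ¬ 2 ∣ suc j × fromℕ j ≤ x × x ≤ fromℕ (suc j)
T⇒unit-interval x (inj₁ (0<x , x≤1)) =
  0<x , 0 , (λ { (divides zero ()) ; (divides (suc _) ()) }) , <⇒≤ 0ℝ x 0<x , x≤1
-- The odd `k` of the definition is `suc j` here, so `3 ≤ k` leaves `2 ≤ j`, whence positivity.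
T⇒unit-interval x (inj₂ (suc j , odd , s≤s 2≤j , k-1≤x , x≤k)) =
  <-≤-trans 0ℝ (fromℕ j) x 0<j j≤x , j , odd , j≤x , x≤k
  where
  j≤x : fromℕ j ≤ x
  j≤x = ≤-trans (fromℕ j) (fromℕ (suc j) - 1ℝ) x
    (pointwise⇒≤ (fromℕ j) (fromℕ (suc j) - 1ℝ) λ _ → sym (trans
      (cong (ℚ._- 1ℚ) (ι-+ 1 j)) (solve 1 (λ a → con 1ℚ :+ a :- con 1ℚ := a) refl (ι j))))
    k-1≤x
    where open ℚ.+-*-Solver
  0<j : 0ℝ < fromℕ j
  0<j = 1ℚ , 0<1 , 0 , λ _ _ → ι-mono-≤ (ℕ.≤-trans (s≤s z≤n) 2≤j)

-- Says that `n` is not strictly between `x` and `y`, as a disjunction from which the common sign of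
-- `n - x` and `n - y` can be read off.
SameSide : ℝ → ℝ → ℕ → Set
SameSide x y n = (x ≤ fromℕ n × y ≤ fromℕ n) ⊎ (fromℕ n ≤ x × fromℕ n ≤ y)

SameSide-swap : ∀ {x y n} → SameSide x y n → SameSide y x n
SameSide-swap (inj₁ (a , b)) = inj₁ (b , a)
SameSide-swap (inj₂ (a , b)) = inj₂ (b , a)

∣x-y∣≤1⇒y≤1+x : ∀ x y → ∣ x - y ∣ ≤ 1ℝ → y ≤ 1ℝ + x
∣x-y∣≤1⇒y≤1+x x y close = ≤-trans y (∣ x - y ∣ + x) (1ℝ + x)
  (eventually-≤⇒≤ y (∣ x - y ∣ + x) (0 , λ n _ →
    subst (ℚ._≤ ℚ.∣ seq x n ℚ.- seq y n ∣ ℚ.+ seq x n)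
      (solve 2 (λ a b → b :- a :+ a := b) refl (seq x n) (seq y n))
      (ℚ.+-monoˡ-≤ (seq x n) (subst (seq y n ℚ.- seq x n ℚ.≤_) (∣p-q∣≡∣q-p∣ (seq y n) (seq x n))
        (p≤∣p∣ (seq y n ℚ.- seq x n))))))
  (+-mono-≤ ∣ x - y ∣ 1ℝ x x close (pointwise⇒≤ x x λ _ → refl))
  where open ℚ.+-*-Solver

-- Two unit intervals of T that differ are at distance at least 1, so ∣ x - y ∣ ≤ 1 forces
-- x = j + 1 and y = k = j + 2, which are consecutive integers.
separated⇒SameSide : ∀ x y j k → suc j ℕ.< k → x ≤ fromℕ (suc j) → fromℕ k ≤ y → y ≤ 1ℝ + x →
  ∀ n → SameSide x y n
separated⇒SameSide x y j k 1+j<k x≤1+j k≤y y≤1+x n with n ℕ.≤? suc j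
... | yes n≤1+j = inj₂
  (≤-trans (fromℕ n) (fromℕ (suc j)) x (fromℕ-mono-≤ n≤1+j) 1+j≤x ,
   ≤-trans (fromℕ n) (fromℕ k) y (fromℕ-mono-≤ (ℕ.≤-trans n≤1+j (ℕ.<⇒≤ 1+j<k))) k≤y)
  where
  open ℚ.+-*-Solver
  1+j≤x : fromℕ (suc j) ≤ x
  1+j≤x = ≤-trans (fromℕ (suc j)) (fromℕ (suc (suc j)) - 1ℝ) x
    (pointwise⇒≤ (fromℕ (suc j)) (fromℕ (suc (suc j)) - 1ℝ) λ _ → sym (trans
      (cong (ℚ._- 1ℚ) (ι-+ 1 (suc j))) (solve 1 (λ a → con 1ℚ :+ a :- con 1ℚ := a) refl (ι (suc j)))))
    (≤-trans (fromℕ (suc (suc j)) - 1ℝ) ((1ℝ + x) - 1ℝ) x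
      (+-mono-≤ (fromℕ (suc (suc j))) (1ℝ + x) (- 1ℝ) (- 1ℝ)
        (≤-trans (fromℕ (suc (suc j))) (fromℕ k) (1ℝ + x) (fromℕ-mono-≤ 1+j<k)
          (≤-trans (fromℕ k) y (1ℝ + x) k≤y y≤1+x))
        (pointwise⇒≤ (- 1ℝ) (- 1ℝ) λ _ → refl))
      (pointwise⇒≤ ((1ℝ + x) - 1ℝ) x λ m →
        solve 1 (λ a → con 1ℚ :+ a :- con 1ℚ := a) refl (seq x m)))
... | no n≰1+j = inj₁
  (≤-trans x (fromℕ (suc j)) (fromℕ n) x≤1+j (fromℕ-mono-≤ (ℕ.<⇒≤ 1+j<n)) ,
   ≤-trans y (1ℝ + x) (fromℕ n) y≤1+x (≤-trans (1ℝ + x) (1ℝ + fromℕ (suc j)) (fromℕ n)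
     (+-mono-≤ 1ℝ 1ℝ x (fromℕ (suc j)) (pointwise⇒≤ 1ℝ 1ℝ λ _ → refl) x≤1+j)
     (≤-trans (1ℝ + fromℕ (suc j)) (fromℕ (suc (suc j))) (fromℕ n)
       (pointwise⇒≤ (1ℝ + fromℕ (suc j)) (fromℕ (suc (suc j))) λ _ → sym (ι-+ 1 (suc j)))
       (fromℕ-mono-≤ 1+j<n))))
  where
  1+j<n = ℕ.≰⇒> n≰1+j

-- If both points lie in the same `[j, j + 1]`, every integer is at most `j` or at least `j + 1`;
-- otherwise the intervals are separated by `odd-gap`. All case distinctions are between natural
-- numbers, so no real comparison has to be decided.
𝒰⇒SameSide : ∀ x y → (x , y) ∈ 𝒰 → ∀ n → SameSide x y n
𝒰⇒SameSide x y (Tx , Ty , close) n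
  with T⇒unit-interval x Tx | T⇒unit-interval y Ty
... | _ , j , odd-j , j≤x , x≤1+j | _ , k , odd-k , k≤y , y≤1+k with ℕ.<-cmp j k
... | tri< j<k _ _ = separated⇒SameSide x y j k (odd-gap odd-j odd-k j<k) x≤1+j k≤y (∣x-y∣≤1⇒y≤1+x x y close) n
... | tri> _ _ k<j = SameSide-swap {y} {x} {n} (separated⇒SameSide y x k j (odd-gap odd-k odd-j k<j) y≤1+k j≤x
    (∣x-y∣≤1⇒y≤1+x y x (≤-trans ∣ y - x ∣ ∣ x - y ∣ 1ℝ
      (pointwise⇒≤ ∣ y - x ∣ ∣ x - y ∣ λ m → ∣p-q∣≡∣q-p∣ (seq y m) (seq x m)) close)) n)
... | tri≈ _ refl _ with n ℕ.≤? j
... | yes n≤j = inj₂ (≤-trans (fromℕ n) (fromℕ j) x (fromℕ-mono-≤ n≤j) j≤x ,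
                      ≤-trans (fromℕ n) (fromℕ j) y (fromℕ-mono-≤ n≤j) k≤y)
... | no n≰j = inj₁ (≤-trans x (fromℕ (suc j)) (fromℕ n) x≤1+j (fromℕ-mono-≤ (ℕ.≰⇒> n≰j)) ,
                     ≤-trans y (fromℕ (suc j)) (fromℕ n) y≤1+k (fromℕ-mono-≤ (ℕ.≰⇒> n≰j)))

SameSide⇒0≤product : ∀ x y n → SameSide x y n → 0ℝ ≤ (fromℕ n - x) * (fromℕ n - y)
SameSide⇒0≤product x y n (inj₁ (x≤n , y≤n)) =
  0≤x*y (fromℕ n - x) (fromℕ n - y) (x≤y⇒0≤y-x x (fromℕ n) x≤n) (x≤y⇒0≤y-x y (fromℕ n) y≤n)
SameSide⇒0≤product x y n (inj₂ (n≤x , n≤y)) =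
  ≤-trans 0ℝ ((x - fromℕ n) * (y - fromℕ n)) ((fromℕ n - x) * (fromℕ n - y))
    (0≤x*y (x - fromℕ n) (y - fromℕ n) (x≤y⇒0≤y-x (fromℕ n) x n≤x) (x≤y⇒0≤y-x (fromℕ n) y n≤y))
    (pointwise⇒≤ ((x - fromℕ n) * (y - fromℕ n)) ((fromℕ n - x) * (fromℕ n - y)) λ m →
      solve 3 (λ a b c → (a :- c) :* (b :- c) := (c :- a) :* (c :- b)) refl (seq x m) (seq y m) (ι n))
  where open ℚ.+-*-Solver

-- The quadratic weight of an element and its nonnegativity.

module _ (x y : ℝ) where

  -- For one element `a`, `ν` counts its prime divisors in [w, z), `π` counts pairs of them, and `g`
  -- is 1 or 0 according to whether `ν` is positive. The expression is linear in the triple, so the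
  -- same formula serves for the sums over all sifted elements.
  weight : ℕ → ℕ → ℕ → ℝ
  weight g ν π = x * y * fromℕ g - (x + y - 1ℝ) * fromℕ ν + fromℕ 2 * fromℕ π

  0≤weight-+ : ∀ g ν π g′ ν′ π′ → 0ℝ ≤ weight g ν π → 0ℝ ≤ weight g′ ν′ π′ →
    0ℝ ≤ weight (g ℕ.+ g′) (ν ℕ.+ ν′) (π ℕ.+ π′)
  0≤weight-+ g ν π g′ ν′ π′ h h′ = ≤-trans 0ℝ (weight g ν π + weight g′ ν′ π′) w
    (≤-trans 0ℝ (0ℝ + 0ℝ) (weight g ν π + weight g′ ν′ π′) (pointwise⇒≤ 0ℝ (0ℝ + 0ℝ) λ _ → refl)
      (+-mono-≤ 0ℝ (weight g ν π) 0ℝ (weight g′ ν′ π′) h h′))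
    (pointwise⇒≤ (weight g ν π + weight g′ ν′ π′) w λ n → sym (split n))
    where
    open ℚ.+-*-Solver
    w = weight (g ℕ.+ g′) (ν ℕ.+ ν′) (π ℕ.+ π′)
    split : ∀ n → seq w n ≡ seq (weight g ν π) n ℚ.+ seq (weight g′ ν′ π′) n
    split n rewrite ι-+ g g′ | ι-+ ν ν′ | ι-+ π π′ =
      solve 9 (λ p c t g ν π g′ ν′ π′ → p :* (g :+ g′) :- c :* (ν :+ ν′) :+ t :* (π :+ π′)
        := (p :* g :- c :* ν :+ t :* π) :+ (p :* g′ :- c :* ν′ :+ t :* π′)) refl
        (seq x n ℚ.* seq y n) (seq x n ℚ.+ seq y n ℚ.- 1ℚ) (ι 2)
        (ι g) (ι ν) (ι π) (ι g′) (ι ν′) (ι π′)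

  0≤weight-0 : 0ℝ ≤ weight 0 0 0
  0≤weight-0 = pointwise⇒≤ 0ℝ (weight 0 0 0) λ n →
    solve 2 (λ p c → con 0ℚ := p :* con 0ℚ :- c :* con 0ℚ :+ con (ι 2) :* con 0ℚ) refl
      (seq x n ℚ.* seq y n) (seq x n ℚ.+ seq y n ℚ.- 1ℚ)
    where open ℚ.+-*-Solver

  0≤weight-∑ : ∀ ns (g ν π : ℕ → ℕ) → (∀ n → 0ℝ ≤ weight (g n) (ν n) (π n)) →
    0ℝ ≤ weight (∑ ns g) (∑ ns ν) (∑ ns π)
  0≤weight-∑ []       g ν π h = 0≤weight-0
  0≤weight-∑ (n ∷ ns) g ν π h =
    0≤weight-+ (g n) (ν n) (π n) (∑ ns g) (∑ ns ν) (∑ ns π) (h n) (0≤weight-∑ ns g ν π h)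

  -- For positive `ν` the relation `2π + ν = ν²` turns the weight into `(ν - x) * (ν - y)`. The
  -- coefficient `1 ⊓ ν` makes elements with `ν = 0` contribute nothing, since their `x * y` is
  -- accounted for by S(𝒜, z).
  0≤weight : ∀ ν π → 2 ℕ.* π ℕ.+ ν ≡ ν ℕ.* ν → SameSide x y ν → 0ℝ ≤ weight (1 ℕ.⊓ ν) ν π
  -- With `ν = 0` the relation forces `π = 0`, so a successor `π` is ruled out by its type.
  0≤weight zero    zero _ _ = 0≤weight-0
  0≤weight ν@(suc _) π 2π+ν≡ν² side =
    ≤-trans 0ℝ ((fromℕ ν - x) * (fromℕ ν - y)) (weight 1 ν π) (SameSide⇒0≤product x y ν side)
      (pointwise⇒≤ ((fromℕ ν - x) * (fromℕ ν - y)) (weight 1 ν π) λ n → sym (expand (seq x n) (seq y n)))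
    where
    open ℚ.+-*-Solver
    open ≡-Reasoning
    square : ι 2 ℚ.* ι π ℚ.+ ι ν ≡ ι ν ℚ.* ι ν
    square = begin
      ι 2 ℚ.* ι π ℚ.+ ι ν       ≡⟨ cong (ℚ._+ ι ν) (ι-* 2 π) ⟨
      ι (2 ℕ.* π) ℚ.+ ι ν       ≡⟨ ι-+ (2 ℕ.* π) ν ⟨
      ι (2 ℕ.* π ℕ.+ ν)         ≡⟨ cong ι 2π+ν≡ν² ⟩
      ι (ν ℕ.* ν)               ≡⟨ ι-* ν ν ⟩
      ι ν ℚ.* ι ν               ∎
    expand : ∀ a b → a ℚ.* b ℚ.* ι 1 ℚ.- (a ℚ.+ b ℚ.- 1ℚ) ℚ.* ι ν ℚ.+ ι 2 ℚ.* ι π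
      ≡ (ι ν ℚ.- a) ℚ.* (ι ν ℚ.- b)
    expand a b = begin
      a ℚ.* b ℚ.* ι 1 ℚ.- (a ℚ.+ b ℚ.- 1ℚ) ℚ.* ι ν ℚ.+ ι 2 ℚ.* ι π
        ≡⟨ solve 4 (λ a b v t → a :* b :* con 1ℚ :- (a :+ b :- con 1ℚ) :* v :+ t
             := a :* b :- (a :+ b) :* v :+ (t :+ v)) refl a b (ι ν) (ι 2 ℚ.* ι π) ⟩
      a ℚ.* b ℚ.- (a ℚ.+ b) ℚ.* ι ν ℚ.+ (ι 2 ℚ.* ι π ℚ.+ ι ν)
        ≡⟨ cong (a ℚ.* b ℚ.- (a ℚ.+ b) ℚ.* ι ν ℚ.+_) square ⟩
      a ℚ.* b ℚ.- (a ℚ.+ b) ℚ.* ι ν ℚ.+ ι ν ℚ.* ι ν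
        ≡⟨ solve 3 (λ a b v → a :* b :- (a :+ b) :* v :+ v :* v := (v :- a) :* (v :- b)) refl a b (ι ν) ⟩
      (ι ν ℚ.- a) ℚ.* (ι ν ℚ.- b) ∎

-- Divisibility by primes.

prime∣prime⇒≡ : ∀ {p q} → Prime p → Prime q → p ∣ q → p ≡ q
prime∣prime⇒≡ prime-p prime-q p∣q with prime⇒irreducible prime-q p∣q
... | inj₂ p≡q  = p≡q
... | inj₁ refl = contradiction prime-p λ ()

primes-*-∣ : ∀ {p q a} → Prime p → Prime q → p ≢ q → p ∣ a → q ∣ a → p ℕ.* q ∣ a
primes-*-∣ {p} {q} prime-p prime-q p≢q (divides b refl) q∣bp with euclidsLemma b p prime-q q∣bp
... | inj₁ (divides c refl) = divides c (trans (ℕ.*-assoc c q p) (cong (c ℕ.*_) (ℕ.*-comm q p)))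
... | inj₂ q∣p = contradiction (sym (prime∣prime⇒≡ prime-q prime-p q∣p)) p≢q

-- Division of the weight by `x * y`.

-- Here `q` and `r` stand for terms of `x * y` and of its reciprocal. The subtracted `g` cancels
-- against `q * r * g`, which leaves the right-hand side of the theorem.
expand-weight : ∀ q r c k t g ν π → q ℚ.* r ≡ 1ℚ →
  t ℚ.- g ℚ.+ r ℚ.* (q ℚ.* g ℚ.- c ℚ.* ν ℚ.+ k ℚ.* π) ≡ t ℚ.- c ℚ.* r ℚ.* ν ℚ.+ k ℚ.* r ℚ.* π
expand-weight q r c k t g ν π qr≡1 = begin
  t ℚ.- g ℚ.+ r ℚ.* (q ℚ.* g ℚ.- c ℚ.* ν ℚ.+ k ℚ.* π)
    ≡⟨ solve 8 (λ q r c k t g ν π → t :- g :+ r :* (q :* g :- c :* ν :+ k :* π)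
         := t :- c :* r :* ν :+ k :* r :* π :+ (q :* r :* g :- g)) refl q r c k t g ν π ⟩
  t ℚ.- c ℚ.* r ℚ.* ν ℚ.+ k ℚ.* r ℚ.* π ℚ.+ (q ℚ.* r ℚ.* g ℚ.- g)
    ≡⟨ cong (λ u → t ℚ.- c ℚ.* r ℚ.* ν ℚ.+ k ℚ.* r ℚ.* π ℚ.+ (u ℚ.* g ℚ.- g)) qr≡1 ⟩
  t ℚ.- c ℚ.* r ℚ.* ν ℚ.+ k ℚ.* r ℚ.* π ℚ.+ (1ℚ ℚ.* g ℚ.- g)
    ≡⟨ solve 2 (λ a g → a :+ (con 1ℚ :* g :- g) := a) refl (t ℚ.- c ℚ.* r ℚ.* ν ℚ.+ k ℚ.* r ℚ.* π) g ⟩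
  t ℚ.- c ℚ.* r ℚ.* ν ℚ.+ k ℚ.* r ℚ.* π ∎
  where
  open ℚ.+-*-Solver
  open ≡-Reasoning

-- The chain is `s ≤ t - g ≤ t - g + r * W`, with `r` and `W` nonnegative, and the last expression
-- is the one wanted by `expand-weight`.
reciprocal-weight : ∀ x y (xy#0 : 0ℝ < ∣ x * y ∣) → 0ℝ < x * y →
  ∀ s t g ν π → s ℕ.+ g ℕ.≤ t → 0ℝ ≤ weight x y g ν π →
  fromℕ s ≤ fromℕ t - (x + y - 1ℝ) * reciprocal (x * y) xy#0 * fromℕ ν
                    + fromℕ 2 * reciprocal (x * y) xy#0 * fromℕ π
reciprocal-weight x y xy#0 0<xy s t g ν π s+g≤t 0≤weight =
  ≤-trans (fromℕ s) (fromℕ t - fromℕ g + r * W) rhs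
    (≤-trans (fromℕ s) (fromℕ t - fromℕ g + 0ℝ) (fromℕ t - fromℕ g + r * W)
      (eventually-≤⇒≤ (fromℕ s) (fromℕ t - fromℕ g + 0ℝ) (0 , λ _ _ → s≤t-g))
      (+-mono-≤ (fromℕ t - fromℕ g) (fromℕ t - fromℕ g) 0ℝ (r * W)
        (pointwise⇒≤ (fromℕ t - fromℕ g) (fromℕ t - fromℕ g) λ _ → refl)
        (0≤x*y r W 0≤r 0≤weight)))
    (eventually-≤⇒≤ (fromℕ t - fromℕ g + r * W) rhs
      -- The equality of terms is claimed only from some index on: earlier terms of `x * y` may
      -- vanish, where `inv` takes its default value 0.
      (map₂ (λ pos n ≤n → ℚ.≤-reflexive
        (expand-weight (seq (x * y) n) (seq r n) (seq (x + y - 1ℝ) n) (ι 2) (ι t) (ι g) (ι ν) (ι π)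
          (*-inv (seq (x * y) n) (ℚ.<⇒≢ (pos n ≤n) ∘ sym)))) 0<xyₙ))
  where
  open ℚ.+-*-Solver
  r = reciprocal (x * y) xy#0
  W = weight x y g ν π
  rhs = fromℕ t - (x + y - 1ℝ) * r * fromℕ ν + fromℕ 2 * r * fromℕ π
  0<xyₙ = 0<x⇒0<xₙ (x * y) 0<xy
  0≤r : 0ℝ ≤ r
  0≤r = eventually-≤⇒≤ 0ℝ r (map₂ (λ pos n ≤n → 0≤inv (pos n ≤n)) 0<xyₙ)
  s≤t-g : ι s ℚ.≤ ι t ℚ.- ι g ℚ.+ 0ℚ
  s≤t-g = subst (ℚ._≤ ι t ℚ.- ι g ℚ.+ 0ℚ)
    (solve 2 (λ s g → s :+ g :- g :+ con 0ℚ := s) refl (ι s) (ι g))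
    (ℚ.+-monoˡ-≤ 0ℚ (ℚ.+-monoˡ-≤ (ℚ.- ι g) (subst (ℚ._≤ ι t) (ι-+ s g) (ι-mono-≤ s+g≤t))))

-- Sifted elements, and sums over primes as sums over them.

module _ (em : ExcludedMiddle 0ℓ) where
  open Classical em

  noPrimeFactorBelow? : ∀ z a → Dec (NoPrimeFactorBelow z a)
  noPrimeFactorBelow? z a = em

  sifted : FinSet⁺ → ℝ → List ℕ
  sifted 𝒜 z = filter (noPrimeFactorBelow? z) (elements 𝒜)

  NoPrimeFactorBelow-∣ : ∀ z {a b} → a ∣ b → NoPrimeFactorBelow z b → NoPrimeFactorBelow z a
  NoPrimeFactorBelow-∣ z a∣b rough (p , prime-p , p∣a , p<z) = rough (p , prime-p , ∣-trans p∣a a∣b , p<z)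

  NoPrimeFactorBelow-* : ∀ z {a b} → NoPrimeFactorBelow z a → NoPrimeFactorBelow z b →
    NoPrimeFactorBelow z (a ℕ.* b)
  NoPrimeFactorBelow-* z {a} {b} rough-a rough-b (p , prime-p , p∣ab , p<z) =
    [ (λ p∣a → rough-a (p , prime-p , p∣a , p<z)) , (λ p∣b → rough-b (p , prime-p , p∣b , p<z)) ]′
      (euclidsLemma a b prime-p p∣ab)

  -- The only prime factor of `p` is `p` itself, which is at least `w`.
  PrimeIn⇒NoPrimeFactorBelow : ∀ w z {p} → PrimeIn w z p → NoPrimeFactorBelow w p
  PrimeIn⇒NoPrimeFactorBelow w z {p} (prime-p , w≤p , _) (q , prime-q , q∣p , q<w)
    with refl ← prime∣prime⇒≡ prime-q prime-p q∣p =
    <-irrefl (fromℕ p) (<-≤-trans (fromℕ p) w (fromℕ p) q<w w≤p)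

  -- Multiplication by `d` is a bijection from the sifted elements of 𝒜_d to the multiples of `d`
  -- among those of 𝒜: as `d` has no prime factor below `w`, neither `b` nor `b * d` can be sifted
  -- out without the other.
  S-⟨⟩ : ∀ 𝒜 w d .{{_ : NonZero d}} → NoPrimeFactorBelow w d →
    S (𝒜 ⟨ d ⟩) w ≡ (∑[ a ∈ sifted 𝒜 w ] 𝟙 (d ∣? a))
  S-⟨⟩ 𝒜 w d rough-d = begin
    length (sifted (𝒜 ⟨ d ⟩) w)                   ≡⟨ length-map (ℕ._* d) (sifted (𝒜 ⟨ d ⟩) w) ⟨
    -- Two duplicate-free lists with the same members are permutations of each other; on the left
    -- this uses that multiplication by a nonzero `d` is injective.
    length (map (ℕ._* d) (sifted (𝒜 ⟨ d ⟩) w))    ≡⟨ ↭-length (∼bag⇒↭ (unique∧set⇒bag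
      (Unique.map⁺ (ℕ.*-cancelʳ-≡ _ _ d) (Unique.filter⁺ (noPrimeFactorBelow? w) (unique (𝒜 ⟨ d ⟩))))
      (Unique.filter⁺ (d ∣?_) (Unique.filter⁺ (noPrimeFactorBelow? w) (unique 𝒜)))
      (mk⇔ to from))) ⟩
    length (filter (d ∣?_) (sifted 𝒜 w))          ≡⟨ length-filter≡∑ (d ∣?_) (sifted 𝒜 w) ⟩
    (∑[ a ∈ sifted 𝒜 w ] 𝟙 (d ∣? a))              ∎
    where
    open ≡-Reasoning
    to : ∀ {a} → a List.∈ map (ℕ._* d) (sifted (𝒜 ⟨ d ⟩) w) → a List.∈ filter (d ∣?_) (sifted 𝒜 w)
    to a∈ with ∈-map⁻ (ℕ._* d) a∈
    ... | b , b∈ , refl with ∈-filter⁻ (noPrimeFactorBelow? w) {xs = elements (𝒜 ⟨ d ⟩)} b∈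
    ... | b∈𝒜⟨d⟩ , rough-b = ∈-filter⁺ (d ∣?_)
      (∈-filter⁺ (noPrimeFactorBelow? w) (Equivalence.to (∈-⟨⟩ 𝒜 d b) b∈𝒜⟨d⟩)
        (NoPrimeFactorBelow-* w rough-b rough-d))
      (n∣m*n b)
    from : ∀ {a} → a List.∈ filter (d ∣?_) (sifted 𝒜 w) → a List.∈ map (ℕ._* d) (sifted (𝒜 ⟨ d ⟩) w)
    from a∈ with ∈-filter⁻ (d ∣?_) {xs = sifted 𝒜 w} a∈
    ... | a∈sifted , divides b refl with ∈-filter⁻ (noPrimeFactorBelow? w) {xs = elements 𝒜} a∈sifted
    ... | a∈𝒜 , rough-a = ∈-map⁺ (ℕ._* d) (∈-filter⁺ (noPrimeFactorBelow? w)
      (Equivalence.from (∈-⟨⟩ 𝒜 d b) a∈𝒜)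
      (NoPrimeFactorBelow-∣ w (m∣m*n d) rough-a))

  primesIn-sorted : ∀ w z → AllPairs ℕ._<_ (primesIn w z)
  primesIn-sorted w z = AllPairs.filter⁺ (primeIn? w z) (AllPairs.applyUpTo⁺₁ id (bound z) λ i<j _ → i<j)

  module _ (w z : ℝ) where

    -- This is the ν(a) of the opening comment.
    ω : ℕ → ℕ
    ω a = ∑[ p ∈ primesIn w z ] 𝟙 (p ∣? a)

    pairs : ℕ → ℕ
    pairs a = ∑[ p₁ ∈ primesIn w z ] ∑[ p₂ ∈ filter (_<? p₁) (primesIn w z) ]
      𝟙 (p₁ ∣? a) ℕ.* 𝟙 (p₂ ∣? a)

    -- An indicator equals its square, so the diagonal in `∑-below` is `ω a`. Thus `pairs a` is
    -- `ω a` choose 2, written additively to avoid truncated subtraction.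
    pairs-ω : ∀ a → 2 ℕ.* pairs a ℕ.+ ω a ≡ ω a ℕ.* ω a
    pairs-ω a = trans
      (cong (2 ℕ.* pairs a ℕ.+_) (∑-cong (primesIn w z) λ {p} _ → sym (𝟙-idem (p ∣? a))))
      (∑-below (primesIn-sorted w z) (λ p → 𝟙 (p ∣? a)))

    ∈⇒PrimeIn : ∀ {p} → p List.∈ primesIn w z → PrimeIn w z p
    ∈⇒PrimeIn {p} = Equivalence.to (∈-primesIn w z p)

    ∑-S-prime : ∀ 𝒜 → (∑[ p ∈ primesIn w z ] S (𝒜 ⟨ p ⟩) w) ≡ ∑ (sifted 𝒜 w) ω
    ∑-S-prime 𝒜 = trans
      (∑-cong (primesIn w z) λ {p} p∈ → S-⟨⟩ 𝒜 w p {{prime⇒nonZero (proj₁ (∈⇒PrimeIn p∈))}}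
        (PrimeIn⇒NoPrimeFactorBelow w z (∈⇒PrimeIn p∈)))
      (∑-comm (primesIn w z) (sifted 𝒜 w) (λ p a → 𝟙 (p ∣? a)))

    -- As `q < p` are distinct primes, their product divides `a` exactly when both do, so the
    -- indicator of `p * q` factors.
    S-prime-pair : ∀ 𝒜 {p q} → PrimeIn w z p → PrimeIn w z q → q ℕ.< p →
      S (𝒜 ⟨ p ℕ.* q ⟩) w ≡ (∑[ a ∈ sifted 𝒜 w ] 𝟙 (p ∣? a) ℕ.* 𝟙 (q ∣? a))
    S-prime-pair 𝒜 {p} {q} p-in@(prime-p , _) q-in@(prime-q , _) q<p = trans
      (S-⟨⟩ 𝒜 w (p ℕ.* q) {{ℕ.m*n≢0 p q {{prime⇒nonZero prime-p}} {{prime⇒nonZero prime-q}}}}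
        (NoPrimeFactorBelow-* w (PrimeIn⇒NoPrimeFactorBelow w z p-in) (PrimeIn⇒NoPrimeFactorBelow w z q-in)))
      (∑-cong (sifted 𝒜 w) λ {a} _ → 𝟙-× (p ℕ.* q ∣? a) (p ∣? a) (q ∣? a)
        (λ pq∣a → ∣-trans (m∣m*n q) pq∣a , ∣-trans (n∣m*n p) pq∣a)
        (primes-*-∣ prime-p prime-q (ℕ.<⇒≢ q<p ∘ sym)))

    ∑-S-prime-pair : ∀ 𝒜 →
      (∑[ p₁ ∈ primesIn w z ] ∑[ p₂ ∈ filter (_<? p₁) (primesIn w z) ] S (𝒜 ⟨ p₁ ℕ.* p₂ ⟩) w)
        ≡ ∑ (sifted 𝒜 w) pairs
    ∑-S-prime-pair 𝒜 = trans
      (∑-cong (primesIn w z) λ {p₁} p₁∈ → trans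
        (∑-cong (below p₁) λ {p₂} p₂∈ →
          let p₂∈P , p₂<p₁ = ∈-filter⁻ (_<? p₁) {xs = primesIn w z} p₂∈
          in S-prime-pair 𝒜 (∈⇒PrimeIn p₁∈) (∈⇒PrimeIn p₂∈P) p₂<p₁)
        (∑-comm (below p₁) (sifted 𝒜 w) (λ p₂ a → 𝟙 (p₁ ∣? a) ℕ.* 𝟙 (p₂ ∣? a))))
      (∑-comm (primesIn w z) (sifted 𝒜 w)
        (λ p₁ a → ∑[ p₂ ∈ below p₁ ] 𝟙 (p₁ ∣? a) ℕ.* 𝟙 (p₂ ∣? a)))
      where
      below : ℕ → List ℕ
      below p₁ = filter (_<? p₁) (primesIn w z)

    -- An element that survives sifting up to `z` survives sifting up to `w ≤ z` and has no prime
    -- divisor in [w, z), so its `ω` is 0. The elements with positive `ω` are additional ones in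
    -- S(𝒜, w).
    S-gap : w ≤ z → ∀ 𝒜 → S 𝒜 z ℕ.+ (∑[ a ∈ sifted 𝒜 w ] 1 ℕ.⊓ ω a) ℕ.≤ S 𝒜 w
    S-gap w≤z 𝒜 = length-filter-⊆ (noPrimeFactorBelow? z) (noPrimeFactorBelow? w)
      (λ a → 1 ℕ.⊓ ω a)
      (λ {a} rough →
        (λ { (p , prime-p , p∣a , p<w) → rough (p , prime-p , p∣a , <-≤-trans (fromℕ p) w z p<w w≤z) }) ,
        cong (1 ℕ.⊓_) (trans
          (∑-cong (primesIn w z) λ {p} p∈ → 𝟙-no (p ∣? a) λ p∣a →
            let prime-p , _ , p<z = ∈⇒PrimeIn p∈ in rough (p , prime-p , p∣a , p<z))
          (∑-zero (primesIn w z))))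
      (λ a → ℕ.m⊓n≤m 1 (ω a))
      (elements 𝒜)

  -- The quotient unfolds with the witness that `em` happens to return, which may differ from the
  -- given one, so the witness is existentially quantified. It does not depend on the numerator, and
  -- both quotients of the theorem share it.
  /-reciprocal : ∀ y → 0ℝ < ∣ y ∣ → ∃ λ (y#0 : 0ℝ < ∣ y ∣) → ∀ x → x / y ≡ x * reciprocal y y#0
  /-reciprocal y y#0 with em {0ℝ < ∣ y ∣}
  ... | yes y#0′ = y#0′ , λ _ → refl
  ... | no ¬y#0  = contradiction y#0 ¬y#0

  divide-weight : ∀ x y → 0ℝ < x * y → ∀ s t g ν π → s ℕ.+ g ℕ.≤ t → 0ℝ ≤ weight x y g ν π →
    fromℕ s ≤ fromℕ t - (x + y - 1ℝ) / (x * y) * fromℕ ν + fromℕ 2 / (x * y) * fromℕ π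
  divide-weight x y 0<xy s t g ν π s+g≤t 0≤weight =
    let xy#0 , /-eq = /-reciprocal (x * y) (<-≤-trans 0ℝ (x * y) ∣ x * y ∣ 0<xy (x≤∣x∣ (x * y))) in
    subst₂ (λ c k → fromℕ s ≤ fromℕ t - c * fromℕ ν + k * fromℕ π)
      (sym (/-eq (x + y - 1ℝ))) (sym (/-eq (fromℕ 2)))
      (reciprocal-weight x y xy#0 0<xy s t g ν π s+g≤t 0≤weight)

theorem2 : (em : ExcludedMiddle 0ℓ) → let open Classical em in
    (𝒜 : FinSet⁺) (w z m₁ m₂ : ℝ) → w ≤ z → (m₁ , m₂) ∈ 𝒰 →
    fromℕ (S 𝒜 z) ≤
    fromℕ (S 𝒜 w)
    - (m₁ + m₂ - 1ℝ) / (m₁ * m₂)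
    * fromℕ (∑[ p₁ ∈ primesIn w z ] S (𝒜 ⟨ p₁ ⟩) w)
    + fromℕ 2 / (m₁ * m₂)
    * fromℕ (∑[ p₁ ∈ primesIn w z ]
    ∑[ p₂ ∈ filter (_<? p₁) (primesIn w z) ]
    S (𝒜 ⟨ p₁ ℕ.* p₂ ⟩) w)
theorem2 em 𝒜 w z m₁ m₂ w≤z m∈𝒰@(m₁∈T , m₂∈T , _) =
  -- Both sums over primes are replaced by sums over the `w`-sifted elements `R`, where the weights
  -- can be estimated element by element.
  subst₂ (λ N₁ N₂ → fromℕ (S 𝒜 z) ≤
      fromℕ (S 𝒜 w) - (m₁ + m₂ - 1ℝ) / (m₁ * m₂) * fromℕ N₁ + fromℕ 2 / (m₁ * m₂) * fromℕ N₂)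
    (sym (∑-S-prime em w z 𝒜)) (sym (∑-S-prime-pair em w z 𝒜))
    (divide-weight em m₁ m₂
      (0<x*y m₁ m₂ (proj₁ (T⇒unit-interval m₁ m₁∈T)) (proj₁ (T⇒unit-interval m₂ m₂∈T)))
      (S 𝒜 z) (S 𝒜 w) (∑ R (λ a → 1 ℕ.⊓ ω em w z a)) (∑ R (ω em w z)) (∑ R (pairs em w z))
      (S-gap em w z w≤z 𝒜)
      (0≤weight-∑ m₁ m₂ R (λ a → 1 ℕ.⊓ ω em w z a) (ω em w z) (pairs em w z) λ a →
        0≤weight m₁ m₂ (ω em w z a) (pairs em w z a) (pairs-ω em w z a)
          (𝒰⇒SameSide m₁ m₂ m∈𝒰 (ω em w z a))))
  where
  open Classical em
  R = sifted em 𝒜 w
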